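{- The ideal $\mathcal R$ on $\omega$ generated by the homogeneous sets in some fixed instance of the random graph on $\omega$ is not $\le_K$-homogeneous (in particular, it is not homogeneous).
   Context: An ideal on a set $X$ is a family of subsets of $X$ closed under finite unions and subsets, containing all finite subsets of $X$ and not containing $X$; $\mathcal I^+=\mathcal P(X)\setminus\mathcal I$. The random graph on $\omega$ is the (unique up to isomorphism) countable graph with vertex set $\omega$ such that for any two disjoint finite sets $U,V\subseteq\omega$ there is a vertex outside $U\cup V$ adjacent to all vertices of $U$ and to none of $V$. A set of vertices is homogeneous (in the graph) if it is a clique or an independent set. $\mathcal R$ consists of all subsets of finite unions of homogeneous sets. For ideals $\mathcal I$ on $X$ and $\mathcal K$ on $Y$, $\mathcal I\le_K\mathcal K$ (Katětov order) means that there is $f:Y\to X$ with $f^{ -1}[B]\in\mathcal K$ for all $B\in\mathcal I$; $\mathcal I$ and $\mathcal K$ are isomorphic if there is a bijection $f:Y\to X$ with $f^{ -1}[B]\in\mathcal K\iff B\in\mathcal I$. For $A\in\mathcal I^+$, $\mathcal I\restriction A=\{B\cap A:B\in\mathcal I\}$ (an ideal on $A$). An ideal $\mathcal I$ is homogeneous if $\mathcal I\restriction A$ is isomorphic to $\mathcal I$ for each $A\in\mathcal I^+$, and $\le_K$-homogeneous if $\mathcal I\restriction A\le_K\mathcal I$ and $\mathcal I\le_K\mathcal I\restriction A$ for each $A\in\mathcal I^+$. -}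

module Defs where

open import Data.Empty using (⊥-elim)
open import Data.Irrelevant using ([_])
open import Data.List.Base using (List; []; _∷_; _++_; foldr; map)
open import Data.List.Membership.Propositional using () renaming (_∈_ to _∈ˡ_; _∉_ to _∉ˡ_)
open import Data.List.Membership.Propositional.Properties using (∈-map⁺; ∈-map⁻)
open import Data.List.Relation.Binary.Disjoint.Propositional using (Disjoint)
open import Data.List.Relation.Unary.All using (All; []; _∷_; universal)
open import Data.List.Relation.Unary.All.Properties using (++⁺; map⁺)
open import Data.List.Relation.Unary.Any using (here; there)
open import Data.Nat.Base using (ℕ)
open import Data.Product.Base using (Σ-syntax; ∃-syntax; _×_; _,_; proj₁; proj₂)
open import Data.Refinement using (value; _,_; Refinement-syntax)
open import Data.Sum.Base using (_⊎_; inj₁; inj₂; [_,_]′)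
open import Function.Base using (_∘_)
open import Function.Bundles using (_⇔_; _⤖_; module Bijection)
open import Level using (0ℓ) renaming (suc to lsuc)
open import Relation.Binary.Core using (Rel)
open import Relation.Binary.PropositionalEquality using (_≡_; _≢_; refl; sym)
open import Relation.Nullary.Negation using (¬_; contradiction)
open import Relation.Unary using (Pred; _∈_; _∉_; _⊆_; _≐_; _∪_; _⊢_; ∅; U; ｛_｝)

-- Subsets of X are predicates X → Set; finite subsets are those enumerated
-- by a list.

record Ideal (X : Set) : Set₂ where
  field
    members  : Pred (Pred X 0ℓ) (lsuc 0ℓ)
    ⊆-closed : ∀ {B C : Pred X 0ℓ} → C ⊆ B → B ∈ members → C ∈ members
    ∪-closed : ∀ {B C : Pred X 0ℓ} → B ∈ members → C ∈ members → (B ∪ C) ∈ members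
    finite   : ∀ (xs : List X) → (λ x → x ∈ˡ xs) ∈ members
    proper   : U ∉ members

open Ideal public using (members)

infix 30 _⁺
_⁺ : ∀ {X} → Ideal X → Pred (Pred X 0ℓ) (lsuc 0ℓ)
(I ⁺) A = A ∉ members I

-- The subset A, regarded as a set in its own right, is [ x ∈ X ∣ A x ]: membership
-- proofs are irrelevant, so its elements are determined by their values in X, and
-- B ∩ A, as a subset of it, is value ⊢ B.

restrict : ∀ {X} (I : Ideal X) (A : Pred X 0ℓ) → A ∈ I ⁺ → Ideal [ x ∈ X ∣ A x ]
restrict {X} I A A⁺ = record
  { members  = λ C → ∃[ B ] B ∈ members I × C ≐ (value ⊢ B)
  ; ⊆-closed = λ {B} {C} → ⊆-cl {B} {C}
  ; ∪-closed = λ where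
      (B , B∈I , B⊆ , ⊆B) (C , C∈I , C⊆ , ⊆C) →
        B ∪ C , Ideal.∪-closed I B∈I C∈I
        , [ inj₁ ∘ B⊆ , inj₂ ∘ C⊆ ]′ , [ inj₁ ∘ ⊆B , inj₂ ∘ ⊆C ]′
  ; finite   = λ xs →
      (λ x → x ∈ˡ map value xs) , Ideal.finite I (map value xs)
      , ∈-map⁺ value , λ v∈ → back xs (∈-map⁻ value v∈)
  ; proper   = λ where
      (B , B∈I , U⊆ , _) → A⁺ (Ideal.⊆-closed I (λ {x} a → U⊆ {x , [ a ]} _) B∈I)
  }
  where
  family : Pred (Pred [ x ∈ X ∣ A x ] 0ℓ) (lsuc 0ℓ)
  family C = ∃[ B ] B ∈ members I × C ≐ (value ⊢ B)

  ⊆-cl : ∀ {B C} → C ⊆ B → B ∈ family → C ∈ family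
  ⊆-cl {_} {C} C⊆B (B , B∈I , B⊆ , _) =
    (λ x → ∃[ p ] value p ≡ x × C p)
    , Ideal.⊆-closed I (λ where (p , refl , c) → B⊆ (C⊆B c)) B∈I
    , (λ {p} c → p , refl , c)
    , λ where (p , refl , c) → c

  back : ∀ xs {p : [ x ∈ X ∣ A x ]} →
         (∃[ q ] q ∈ˡ xs × value p ≡ value q) → p ∈ˡ xs
  back xs (q , q∈ , refl) = q∈

infix 4 _≤ᴷ_ _≅_

_≤ᴷ_ : ∀ {X Y} → Ideal X → Ideal Y → Set₁
_≤ᴷ_ {X} {Y} I K =
  Σ[ f ∈ (Y → X) ] (∀ (B : Pred X 0ℓ) → B ∈ members I → (f ⊢ B) ∈ members K)

_≅_ : ∀ {X Y} → Ideal X → Ideal Y → Set₁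
_≅_ {X} {Y} I K =
  Σ[ f ∈ (Y ⤖ X) ] (∀ (B : Pred X 0ℓ) → ((Bijection.to f ⊢ B) ∈ members K) ⇔ (B ∈ members I))

IsHomogeneous : ∀ {X} → Ideal X → Set₁
IsHomogeneous I = ∀ A (A⁺ : A ∈ I ⁺) → restrict I A A⁺ ≅ I

Is≤ᴷ-Homogeneous : ∀ {X} → Ideal X → Set₁
Is≤ᴷ-Homogeneous I = ∀ A (A⁺ : A ∈ I ⁺) → restrict I A A⁺ ≤ᴷ I × I ≤ᴷ restrict I A A⁺

-- Adjacency is not assumed to be decidable.

record RandomGraph : Set₁ where
  field
    Adj         : Rel ℕ 0ℓ
    symmetric   : ∀ {x y} → Adj x y → Adj y x
    irreflexive : ∀ {x} → ¬ Adj x x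

  Extends : (S T : List ℕ) → Pred ℕ 0ℓ
  Extends S T x = x ∉ˡ S × x ∉ˡ T × All (λ s → Adj x s) S × All (λ t → ¬ Adj x t) T

  field
    extension : ∀ (S T : List ℕ) → Disjoint S T → ∃[ x ] Extends S T x

module _ (G : RandomGraph) where
  open RandomGraph G

  IsClique : Pred (Pred ℕ 0ℓ) 0ℓ
  IsClique H = ∀ {x y} → x ∈ H → y ∈ H → x ≢ y → Adj x y

  IsIndependent : Pred (Pred ℕ 0ℓ) 0ℓ
  IsIndependent H = ∀ {x y} → x ∈ H → y ∈ H → ¬ Adj x y

  IsHomogeneousSet : Pred (Pred ℕ 0ℓ) 0ℓ
  IsHomogeneousSet H = IsClique H ⊎ IsIndependent H

  ⋃ˡ : List (Pred ℕ 0ℓ) → Pred ℕ 0ℓ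
  ⋃ˡ = foldr _∪_ ∅

  CoveredByHomogeneous : Pred (Pred ℕ 0ℓ) (lsuc 0ℓ)
  CoveredByHomogeneous B = ∃[ Hs ] All IsHomogeneousSet Hs × B ⊆ ⋃ˡ Hs

  private
    ⋃ˡ-++⁺ˡ : ∀ Hs Ks → ⋃ˡ Hs ⊆ ⋃ˡ (Hs ++ Ks)
    ⋃ˡ-++⁺ˡ (H ∷ Hs) Ks (inj₁ h) = inj₁ h
    ⋃ˡ-++⁺ˡ (H ∷ Hs) Ks (inj₂ r) = inj₂ (⋃ˡ-++⁺ˡ Hs Ks r)

    ⋃ˡ-++⁺ʳ : ∀ Hs Ks → ⋃ˡ Ks ⊆ ⋃ˡ (Hs ++ Ks)
    ⋃ˡ-++⁺ʳ []       Ks r = r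
    ⋃ˡ-++⁺ʳ (H ∷ Hs) Ks r = inj₂ (⋃ˡ-++⁺ʳ Hs Ks r)

    singletons : ∀ xs → (λ x → x ∈ˡ xs) ⊆ ⋃ˡ (map ｛_｝ xs)
    singletons (x ∷ xs) (here eq)  = inj₁ (sym eq)
    singletons (x ∷ xs) (there x∈) = inj₂ (singletons xs x∈)

    singleton-homogeneous : ∀ x → IsHomogeneousSet ｛ x ｝
    singleton-homogeneous x = inj₁ λ where refl refl x≢x → contradiction refl x≢x

  -- If x ∈ H extends (S , T) and H is a clique (independent), then H misses every
  -- extension of (S , x ∷ T) (of (x ∷ S , T)).
  extensions-not-covered : ∀ Hs → All IsHomogeneousSet Hs → ∀ S T → Disjoint S T →
                           ¬ (Extends S T ⊆ ⋃ˡ Hs)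
  extensions-not-covered [] [] S T S#T cov = cov (proj₂ (extension S T S#T))
  extensions-not-covered (H ∷ Hs) (hom ∷ homs) S T S#T cov =
    extensions-not-covered Hs homs S T S#T λ e →
      [ (λ h → ⊥-elim (misses hom e h)) , (λ r → r) ]′ (cov e)
    where
    misses : IsHomogeneousSet H → ∀ {x} → Extends S T x → ¬ H x
    misses (inj₁ clique) {x} (x∉S , x∉T , _) x∈H =
      extensions-not-covered Hs homs S (x ∷ T) disj λ where
        (y∉S , y∉xT , adjS , ¬y~x ∷ nadjT) →
          [ (λ y∈H → ⊥-elim (¬y~x (clique y∈H x∈H (y∉xT ∘ here)))) , (λ r → r) ]′
            (cov (y∉S , y∉xT ∘ there , adjS , nadjT))
      where
      disj : Disjoint S (x ∷ T)
      disj (v∈S , here refl) = x∉S v∈S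
      disj (v∈S , there v∈T) = S#T (v∈S , v∈T)
    misses (inj₂ indep) {x} (x∉S , x∉T , _) x∈H =
      extensions-not-covered Hs homs (x ∷ S) T disj λ where
        (y∉xS , y∉T , y~x ∷ adjS , nadjT) →
          [ (λ y∈H → ⊥-elim (indep y∈H x∈H y~x)) , (λ r → r) ]′
            (cov (y∉xS ∘ there , y∉T , adjS , nadjT))
      where
      disj : Disjoint (x ∷ S) T
      disj (here refl , v∈T) = x∉T v∈T
      disj (there v∈S , v∈T) = S#T (v∈S , v∈T)

  randomGraphIdeal : Ideal ℕ
  randomGraphIdeal = record
    { members  = CoveredByHomogeneous
    ; ⊆-closed = λ where C⊆B (Hs , homs , B⊆) → Hs , homs , λ c → B⊆ (C⊆B c)
    ; ∪-closed = λ where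
        (Hs , homs , B⊆) (Ks , koms , C⊆) →
          Hs ++ Ks , ++⁺ homs koms
          , [ ⋃ˡ-++⁺ˡ Hs Ks ∘ B⊆ , ⋃ˡ-++⁺ʳ Hs Ks ∘ C⊆ ]′
    ; finite   = λ xs →
        map ｛_｝ xs , map⁺ (universal singleton-homogeneous xs) , singletons xs
    ; proper   = λ where
        (Hs , homs , U⊆) →
          extensions-not-covered Hs homs [] [] (λ where (() , _)) (λ _ → U⊆ _)
    }

module Submission where

-- Write R for the ideal of the random graph.  Only one half of the definition
-- is needed: a positive set A such that the restriction of R to A is not
-- Katetov below R.  An isomorphism in particular witnesses a Katetov reduction,
-- so both conclusions follow from this.
--
-- Let A be an induced copy, in the random graph, of the disjoint union of
-- infinitely many infinite cliques ("columns").  A homogeneous subset of such a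
-- copy lies in one column or meets each column at most once, so no finite
-- number of them covers the copy: copies are positive (copy-positive).
--
-- Suppose f : ω → A reduces the restriction of R to A to R, and colour each
-- vertex n by the column of f n.  Columns are cliques, hence every colour class
-- lies in R.  A set Extends S T is never covered by finitely many homogeneous
-- sets, so each one contains vertices of arbitrarily large colour
-- (extension-above), and a second copy of the disjoint union of cliques
-- can be built along which the colour strictly increases (copy-exists).  The
-- image under f of this second copy meets each column of A at most once, hence
-- is independent, hence lies in R.  Its preimage under f contains the second
-- copy, which is positive: a contradiction.
--
-- The set A itself comes from copy-exists, applied to the identity colouring.
-- The whole construction is effective although adjacency is not decidable,
-- because membership in R supplies an actual cover.

open import Defs
open import Data.Empty using (⊥-elim)
open import Data.Irrelevant using ([_])
open import Data.List.Base using (List; []; _∷_; filter; map)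
open import Data.List.Extrema.Nat using (max; xs≤max)
open import Data.List.Membership.Propositional using () renaming (_∈_ to _∈ˡ_)
open import Data.List.Membership.Propositional.Properties
  using (∈-map⁺; ∈-map⁻; ∈-filter⁺; ∈-filter⁻)
open import Data.List.Relation.Binary.Disjoint.Propositional using (Disjoint)
open import Data.List.Relation.Unary.All using (All; []; _∷_; lookup; tabulate)
open import Data.List.Relation.Unary.AllPairs using (AllPairs; []; _∷_)
open import Data.List.Relation.Unary.Any using (here; there)
open import Data.Nat.Base using (ℕ; zero; suc; _+_; _≤_; _<_; z≤n; s≤s)
open import Data.Nat.Properties
  using (_≟_; _<?_; <-cmp; <-irrefl; <⇒≢; <⇒≤; ≤-refl; ≤-trans; ≮⇒≥; ≤-<-trans;
         m<1+n⇒m<n∨m≡n; +-suc; +-identityʳ; m≤m+n; anyUpTo?)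
open import Data.Product.Base using (∃-syntax; _×_; _,_; proj₁; proj₂)
open import Data.Refinement using (value; _,_; Refinement-syntax)
open import Data.Sum.Base using (_⊎_; inj₁; inj₂; [_,_]′)
open import Function.Base using (_∘_; id)
open import Function.Bundles using (Equivalence; module Bijection)
open import Level using (0ℓ)
open import Relation.Binary.Definitions using (tri<; tri≈; tri>)
open import Relation.Binary.PropositionalEquality
  using (_≡_; _≢_; refl; sym; trans; cong)
open import Relation.Nullary.Decidable using (Dec; yes; no; map′; ¬?; recompute)
open import Relation.Nullary.Negation using (¬_)
open import Relation.Unary using (Pred; _∈_; _∉_; _⊆_; _∪_; _⊢_)

-- Enumerating infinitely many infinite columns

-- The walk counts down from b to 0 in its first component and then restarts
-- from b + 1; the second component remembers b.
walk : ℕ → ℕ × ℕ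
walk zero    = 0 , 0
walk (suc n) = next (walk n)
  where
  next : ℕ × ℕ → ℕ × ℕ
  next (zero  , b) = suc b , suc b
  next (suc a , b) = a , b

-- The column to which the n-th point belongs:
-- 0, 1, 0, 2, 1, 0, 3, 2, 1, 0, ...
col : ℕ → ℕ
col = proj₁ ∘ walk

walk-descends : ∀ d {k b n} → walk n ≡ (d + k , b) → walk (d + n) ≡ (k , b)
walk-descends zero    eq = eq
walk-descends (suc d) {k} {b} {n} eq
  rewrite walk-descends d {suc k} {b} {n} (trans eq (cong (_, b) (sym (+-suc d k)))) = refl

walk-reaches-top : ∀ b → ∃[ n ] b ≤ n × walk n ≡ (b , b)
walk-reaches-top zero = 0 , z≤n , refl
walk-reaches-top (suc b) with walk-reaches-top b
... | n , _ , eq = suc (b + n) , s≤s (m≤m+n b n) , restart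
  where
  restart : walk (suc (b + n)) ≡ (suc b , suc b)
  restart rewrite walk-descends b {0} {b} {n}
    (trans eq (cong (_, b) (sym (+-identityʳ b)))) = refl

col-infinite : ∀ k N → ∃[ n ] N ≤ n × col n ≡ k
col-infinite k N with walk-reaches-top (N + k)
... | n , _ , eq = N + n , m≤m+n N n , cong proj₁ (walk-descends N eq)

-- Ideals and colourings

fibres⇒bounded : ∀ {X} (I : Ideal X) (c : X → ℕ) →
                 (∀ k → (λ x → c x ≡ k) ∈ members I) →
                 ∀ b → (λ x → c x < b) ∈ members I
fibres⇒bounded I c fibre zero    = Ideal.⊆-closed I (λ ()) (Ideal.finite I [])
fibres⇒bounded I c fibre (suc b) =
  Ideal.⊆-closed I m<1+n⇒m<n∨m≡n
    (Ideal.∪-closed I (fibres⇒bounded I c fibre b) (fibre b))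

≅⇒≤ᴷ : ∀ {X Y} {I : Ideal X} {K : Ideal Y} → I ≅ K → I ≤ᴷ K
≅⇒≤ᴷ (f , iff) = Bijection.to f , λ B → Equivalence.from (iff B)

module _ (G : RandomGraph) where
  open RandomGraph G

  -- Extensions outside finitely many homogeneous sets

  -- If finitely many homogeneous sets and Q together cover all extensions of
  -- (S , T), then some extension of (S , T) lies in Q.
  extension-in-remainder :
    ∀ Hs → All (IsHomogeneousSet G) Hs → ∀ {Q : Pred ℕ 0ℓ} S T → Disjoint S T →
    Extends S T ⊆ ⋃ˡ G Hs ∪ Q → ∃[ x ] Extends S T x × Q x
  extension-in-remainder [] [] S T S#T cov with extension S T S#T
  ... | x , ext = x , ext , [ (λ ()) , id ]′ (cov ext)
  extension-in-remainder (H ∷ Hs) (hom ∷ homs) {Q} S T S#T cov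
    -- Absorb H into the remainder.
    with extension-in-remainder Hs homs {H ∪ Q} S T S#T
           (λ ext → reassoc (cov ext))
    where
    reassoc : ∀ {x} → (H x ⊎ ⋃ˡ G Hs x) ⊎ Q x → ⋃ˡ G Hs x ⊎ (H x ⊎ Q x)
    reassoc (inj₁ (inj₁ h)) = inj₂ (inj₁ h)
    reassoc (inj₁ (inj₂ u)) = inj₁ u
    reassoc (inj₂ q)        = inj₂ (inj₂ q)
  ... | x , ext , inj₂ q = x , ext , q
  -- The vertex x lies in H; pass to extensions that H misses because of x.
  ... | x , (x∉S , x∉T , _) , inj₁ x∈H = beyond hom
    where
    without-H : ∀ {y} → ¬ H y → (H y ⊎ ⋃ˡ G Hs y) ⊎ Q y → ⋃ˡ G Hs y ⊎ Q y
    without-H y∉H (inj₁ (inj₁ h)) = ⊥-elim (y∉H h)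
    without-H y∉H (inj₁ (inj₂ u)) = inj₁ u
    without-H y∉H (inj₂ q)        = inj₂ q

    beyond : IsHomogeneousSet G H → ∃[ y ] Extends S T y × Q y
    beyond (inj₁ clique)
      with extension-in-remainder Hs homs {Q} S (x ∷ T)
             (λ where (v∈S , here refl) → x∉S v∈S
                      (v∈S , there v∈T) → S#T (v∈S , v∈T))
             (λ where (y∉S , y∉xT , adjS , ¬y~x ∷ nadjT) →
                        without-H (λ y∈H → ¬y~x (clique y∈H x∈H (y∉xT ∘ here)))
                          (cov (y∉S , y∉xT ∘ there , adjS , nadjT)))
    ... | y , (y∉S , y∉xT , adjS , _ ∷ nadjT) , q =
      y , (y∉S , y∉xT ∘ there , adjS , nadjT) , q
    beyond (inj₂ indep)
      with extension-in-remainder Hs homs {Q} (x ∷ S) T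
             (λ where (here refl , v∈T) → x∉T v∈T
                      (there v∈S , v∈T) → S#T (v∈S , v∈T))
             (λ where (y∉xS , y∉T , y~x ∷ adjS , nadjT) →
                        without-H (λ y∈H → indep y∈H x∈H y~x)
                          (cov (y∉xS ∘ there , y∉T , adjS , nadjT)))
    ... | y , (y∉xS , y∉T , _ ∷ adjS , nadjT) , q =
      y , (y∉xS ∘ there , y∉T , adjS , nadjT) , q

  extension-above : ∀ (c : ℕ → ℕ) →
    (∀ k → (λ x → c x ≡ k) ∈ members (randomGraphIdeal G)) →
    ∀ b S T → Disjoint S T → ∃[ x ] Extends S T x × b ≤ c x
  extension-above c fibre b S T S#T with fibres⇒bounded (randomGraphIdeal G) c fibre b
  ... | Hs , homs , small⊆ = extension-in-remainder Hs homs S T S#T λ {x} _ → split x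
    where
    split : ∀ x → ⋃ˡ G Hs x ⊎ b ≤ c x
    split x with c x <? b
    ... | yes small = inj₁ (small⊆ small)
    ... | no ¬small = inj₂ (≮⇒≥ ¬small)

  -- Copies of the disjoint union of infinitely many infinite cliques

  -- Compatible c (k , x) (l , z): the vertex x, meant for column k, may be added
  -- to the copy when the vertex z has already been placed in column l.
  Compatible : (ℕ → ℕ) → ℕ × ℕ → ℕ × ℕ → Set
  Compatible c (k , x) (l , z) = c z < c x × (l ≡ k → Adj x z) × (l ≢ k → ¬ Adj x z)

  -- The vertices y 0, y 1, ... form an induced copy of the disjoint union of the
  -- cliques col ⁻¹ (k), and c is strictly increasing along them.
  IsCopy : (ℕ → ℕ) → (ℕ → ℕ) → Set
  IsCopy c y = ∀ {m n} → m < n → Compatible c (col n , y n) (col m , y m)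

  -- A finite part of a copy, most recent vertex first; each vertex is paired
  -- with its column.
  PartialCopy : (ℕ → ℕ) → Pred (List (ℕ × ℕ)) 0ℓ
  PartialCopy c = AllPairs (Compatible c)

  column-unique : ∀ {c h} → PartialCopy c h → ∀ {k l x} →
                  (k , x) ∈ˡ h → (l , x) ∈ˡ h → k ≡ l
  column-unique (_ ∷ _)  (here refl) (here refl) = refl
  column-unique (r ∷ _)  (here refl) (there q)   =
    ⊥-elim (<-irrefl refl (proj₁ (lookup r q)))
  column-unique (r ∷ _)  (there p)   (here refl) =
    ⊥-elim (<-irrefl refl (proj₁ (lookup r p)))
  column-unique (_ ∷ pc) (there p)   (there q)   = column-unique pc p q

  module _ (c : ℕ → ℕ)
           (fibre : ∀ k → (λ x → c x ≡ k) ∈ members (randomGraphIdeal G)) where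

    partialCopy-extends : ∀ {h} → PartialCopy c h → ∀ k →
                          ∃[ x ] All (Compatible c (k , x)) h
    partialCopy-extends {h} pc k
      with extension-above c fibre (suc (max 0 colours)) S T S#T
      where
      colours = map (c ∘ proj₂) h
      S = map proj₂ (filter (λ p → proj₁ p ≟ k) h)
      T = map proj₂ (filter (λ p → ¬? (proj₁ p ≟ k)) h)
      S#T : Disjoint S T
      S#T (v∈S , v∈T) with ∈-map⁻ proj₂ v∈S | ∈-map⁻ proj₂ v∈T
      ... | (l , _) , p∈ , refl | (m , _) , q∈ , refl
        with ∈-filter⁻ (λ p → proj₁ p ≟ k) p∈ | ∈-filter⁻ (λ p → ¬? (proj₁ p ≟ k)) q∈
      ... | p∈h , l≡k | q∈h , m≢k = m≢k (trans (column-unique pc q∈h p∈h) l≡k)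
    ... | x , (_ , _ , adjS , nadjT) , above = x , tabulate λ {p} p∈h →
        ≤-<-trans (lookup (xs≤max 0 (map (c ∘ proj₂) h)) (∈-map⁺ (c ∘ proj₂) p∈h)) above
      , (λ l≡k → lookup adjS (∈-map⁺ proj₂ (∈-filter⁺ (λ p → proj₁ p ≟ k) p∈h l≡k)))
      , (λ l≢k → lookup nadjT (∈-map⁺ proj₂ (∈-filter⁺ (λ p → ¬? (proj₁ p ≟ k)) p∈h l≢k)))

    copy-exists : ∃[ y ] IsCopy c y
    copy-exists = y , λ {m} {n} m<n → lookup (proj₂ (newest n)) (placed m<n)
      where
      stage : ℕ → ∃[ h ] PartialCopy c h
      newest : ∀ n → ∃[ x ] All (Compatible c (col n , x)) (proj₁ (stage n))
      stage zero    = [] , []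
      stage (suc n) = (col n , proj₁ (newest n)) ∷ proj₁ (stage n)
                    , proj₂ (newest n) ∷ proj₂ (stage n)
      newest n = partialCopy-extends (proj₂ (stage n)) (col n)

      y : ℕ → ℕ
      y n = proj₁ (newest n)

      placed : ∀ {m n} → m < n → (col m , y m) ∈ˡ proj₁ (stage n)
      placed {m} {suc n} m<1+n with m<1+n⇒m<n∨m≡n m<1+n
      ... | inj₁ m<n  = there (placed m<n)
      ... | inj₂ refl = here refl

  module _ {c y : ℕ → ℕ} (copy : IsCopy c y) where

    copy-adjacent : ∀ {m n} → m ≢ n → col m ≡ col n → Adj (y m) (y n)
    copy-adjacent {m} {n} m≢n same with <-cmp m n
    ... | tri< m<n _ _ = symmetric (proj₁ (proj₂ (copy m<n)) same)
    ... | tri≈ _ m≡n _ = ⊥-elim (m≢n m≡n)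
    ... | tri> _ _ n<m = proj₁ (proj₂ (copy n<m)) (sym same)

    copy-nonadjacent : ∀ {m n} → col m ≢ col n → ¬ Adj (y m) (y n)
    copy-nonadjacent {m} {n} diff with <-cmp m n
    ... | tri< m<n _ _ = proj₂ (proj₂ (copy m<n)) diff ∘ symmetric
    ... | tri≈ _ m≡n _ = ⊥-elim (diff (cong col m≡n))
    ... | tri> _ _ n<m = proj₂ (proj₂ (copy n<m)) (diff ∘ sym)

    copy-injective : ∀ {m n} → y m ≡ y n → m ≡ n
    copy-injective {m} {n} eq with <-cmp m n
    ... | tri< m<n _ _ = ⊥-elim (<⇒≢ (proj₁ (copy m<n)) (cong c eq))
    ... | tri≈ _ m≡n _ = m≡n
    ... | tri> _ _ n<m = ⊥-elim (<⇒≢ (proj₁ (copy n<m)) (cong c (sym eq)))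

    -- An independent set contains at most one point of each column.
    column-not-covered : ∀ Is → All (IsIndependent G) Is → ∀ k N →
                         ¬ (∀ {n} → N ≤ n → col n ≡ k → y n ∈ ⋃ˡ G Is)
    column-not-covered [] [] k N cov with col-infinite k N
    ... | n , N≤n , in-k = cov N≤n in-k
    column-not-covered (I ∷ Is) (indep ∷ indeps) k N cov =
      column-not-covered Is indeps k N λ N≤n in-k →
        [ (λ y∈I → ⊥-elim (misses N≤n in-k y∈I)) , id ]′ (cov N≤n in-k)
      where
      misses : ∀ {m} → N ≤ m → col m ≡ k → y m ∉ I
      misses {m} N≤m m-in-k ym∈I =
        column-not-covered Is indeps k (suc m) λ m<n n-in-k →
          [ (λ yn∈I → ⊥-elim (indep ym∈I yn∈I
               (copy-adjacent (<⇒≢ m<n) (trans m-in-k (sym n-in-k))))) , id ]′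
            (cov (≤-trans N≤m (<⇒≤ m<n)) n-in-k)

    -- The independent sets are set aside in Is; a clique meets at most one
    -- column, so it misses all columns beyond the one it meets.
    columns-not-covered : ∀ Hs Is → All (IsHomogeneousSet G) Hs → All (IsIndependent G) Is →
                          ∀ k → ¬ (∀ {n} → k ≤ col n → y n ∈ ⋃ˡ G Hs ∪ ⋃ˡ G Is)
    columns-not-covered [] Is [] indeps k cov =
      column-not-covered Is indeps k 0 λ where _ refl → [ (λ ()) , id ]′ (cov ≤-refl)
    columns-not-covered (H ∷ Hs) Is (inj₂ indep ∷ homs) indeps k cov =
      columns-not-covered Hs (H ∷ Is) homs (indep ∷ indeps) k λ k≤ →
        [ [ inj₂ ∘ inj₁ , inj₁ ]′ , inj₂ ∘ inj₂ ]′ (cov k≤)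
    columns-not-covered (H ∷ Hs) Is (inj₁ clique ∷ homs) indeps k cov =
      columns-not-covered Hs Is homs indeps k λ k≤ →
        [ [ (λ y∈H → ⊥-elim (misses k≤ y∈H)) , inj₁ ]′ , inj₂ ]′ (cov k≤)
      where
      misses : ∀ {m} → k ≤ col m → y m ∉ H
      misses {m} k≤ ym∈H =
        columns-not-covered Hs Is homs indeps (suc (col m)) λ {n} m<n →
          [ [ (λ yn∈H → ⊥-elim (copy-nonadjacent (<⇒≢ m<n)
                (clique ym∈H yn∈H λ eq → <⇒≢ m<n (cong col (copy-injective eq))))) , inj₁ ]′
          , inj₂ ]′ (cov (≤-trans k≤ (<⇒≤ m<n)))

    copy-positive : ∀ {B : Pred ℕ 0ℓ} → (∀ n → y n ∈ B) → B ∈ randomGraphIdeal G ⁺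
    copy-positive y∈B (Hs , homs , B⊆) =
      columns-not-covered Hs [] homs [] 0 λ {n} _ → inj₁ (B⊆ (y∈B n))

  -- The restriction to a copy

  increasing⇒≥ : ∀ {y : ℕ → ℕ} → (∀ {m n} → m < n → y m < y n) → ∀ n → n ≤ y n
  increasing⇒≥ inc zero    = z≤n
  increasing⇒≥ inc (suc n) = ≤-<-trans (increasing⇒≥ inc n) (inc ≤-refl)

  module _ {e : ℕ → ℕ} (copy : IsCopy id e) where

    -- The set of vertices of the copy: the positive set A of the argument.
    Image : Pred ℕ 0ℓ
    Image x = ∃[ n ] e n ≡ x

    Image⁺ : Image ∈ randomGraphIdeal G ⁺
    Image⁺ = copy-positive {c = id} copy (λ n → n , refl)

    -- Since n ≤ e n, an index of x can only be found among 0, ..., x.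
    image? : ∀ x → Dec (Image x)
    image? x = map′
      (λ where (n , _ , eq) → n , eq)
      (λ where (n , refl) → n , s≤s (increasing⇒≥ (proj₁ ∘ copy) n) , refl)
      (anyUpTo? (λ n → e n ≟ x) (suc x))

    -- Membership in Image is irrelevant in a refinement; decidability recovers
    -- the index.
    preimage : (p : [ x ∈ ℕ ∣ Image x ]) → Image (value p)
    preimage (x , [ i ]) = recompute (image? x) i

    -- The column in which a vertex of the copy lies.
    column : [ x ∈ ℕ ∣ Image x ] → ℕ
    column p = col (proj₁ (preimage p))

    column-nonadjacent : ∀ p q → column p ≢ column q → ¬ Adj (value p) (value q)
    column-nonadjacent p q diff adj
      with preimage p | preimage q
    ... | m , refl | n , refl = copy-nonadjacent {c = id} copy diff adj

    -- The vertices of the copy that lie in column k.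
    Column : ℕ → Pred ℕ 0ℓ
    Column k x = ∃[ n ] e n ≡ x × col n ≡ k

    column-clique : ∀ k → IsClique G (Column k)
    column-clique k (m , refl , m-in-k) (n , refl , n-in-k) em≢en =
      copy-adjacent {c = id} copy (em≢en ∘ cong e) (trans m-in-k (sym n-in-k))

    restriction≰ᴷ : ¬ (restrict (randomGraphIdeal G) Image Image⁺ ≤ᴷ randomGraphIdeal G)
    restriction≰ᴷ (f , pullback) = selector-absurd (copy-exists (column ∘ f) fibre)
      where
      fibre : ∀ k → (λ x → column (f x) ≡ k) ∈ members (randomGraphIdeal G)
      fibre k = Ideal.⊆-closed (randomGraphIdeal G) {C = λ x → column (f x) ≡ k}
        (λ {x} in-k → proj₁ (preimage (f x)) , proj₂ (preimage (f x)) , in-k)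
        (pullback (value ⊢ Column k)
          (Column k , (Column k ∷ [] , inj₁ (column-clique k) ∷ [] , inj₁) , id , id))

      selector-absurd : ¬ (∃[ y ] IsCopy (column ∘ f) y)
      selector-absurd (y , copy′) =
        copy-positive {c = column ∘ f} copy′ {B = f ⊢ (value ⊢ Selector)} (λ n → n , refl)
          (pullback (value ⊢ Selector)
            (Selector , (Selector ∷ [] , inj₂ independent ∷ [] , inj₁) , id , id))
        where
        -- The image under f of the second copy y.
        Selector : Pred ℕ 0ℓ
        Selector x = ∃[ n ] value (f (y n)) ≡ x

        -- Distinct indices give distinct columns, as column ∘ f ∘ y is increasing.
        independent : IsIndependent G Selector
        independent (m , refl) (n , refl) with <-cmp m n
        ... | tri< m<n _ _ = column-nonadjacent (f (y m)) (f (y n)) (<⇒≢ (proj₁ (copy′ m<n)))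
        ... | tri≈ _ refl _ = irreflexive
        ... | tri> _ _ n<m = column-nonadjacent (f (y m)) (f (y n)) (<⇒≢ (proj₁ (copy′ n<m)) ∘ sym)

  singletons-in-ideal : ∀ k → (λ x → x ≡ k) ∈ members (randomGraphIdeal G)
  singletons-in-ideal k =
    Ideal.⊆-closed (randomGraphIdeal G) here (Ideal.finite (randomGraphIdeal G) (k ∷ []))

  positive-set-not-≤ᴷ : ∃[ A ] ∃[ A⁺ ] ¬ (restrict (randomGraphIdeal G) A A⁺ ≤ᴷ randomGraphIdeal G)
  positive-set-not-≤ᴷ =
    let e , copy = copy-exists id singletons-in-ideal
    in Image copy , Image⁺ copy , restriction≰ᴷ copy

proposition10p4 : (G : RandomGraph) →
    ¬ Is≤ᴷ-Homogeneous (randomGraphIdeal G) × ¬ IsHomogeneous (randomGraphIdeal G)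
proposition10p4 G =
  let A , A⁺ , ≰ᴷ = positive-set-not-≤ᴷ G
      R = randomGraphIdeal G
  in (λ hom → ≰ᴷ (proj₁ (hom A A⁺)))
   , (λ hom → ≰ᴷ (≅⇒≤ᴷ {I = restrict R A A⁺} {K = R} (hom A A⁺)))
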